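{- Let $T=\{2143,2341,3241\}$. Then $$F_T(x)=\frac{1-4x+3x^2-x^3}{1-5x+6x^2-3x^3}.$$
   Context: $S_n(T)$ denotes the set of permutations $\pi$ of $[n]=\{1,\dots,n\}$ (one-line notation) that avoid every pattern $\tau\in T$, i.e. no subsequence of $\pi$ is order-isomorphic to $\tau$. $F_T(x)=\sum_{n\ge 0}|S_n(T)|x^n$, a formal power series, with $|S_0(T)|=1$. -}

module Defs where

open import Data.Fin.Base using (Fin; toℕ; cast)
open import Data.Fin.Properties using (all?)
open import Data.Integer.Base as ℤ using (ℤ; +_; 0ℤ; 1ℤ)
import Data.Integer.Properties as ℤ
open import Data.List.Base
  using (List; []; _∷_; _++_; length; lookup; map; upTo; filter; cartesianProductWith)
open import Data.List.Membership.Propositional using (_∈_)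
open import Data.List.Membership.Propositional.Properties
  using (∈-∃++; ∈-filter⁺; ∈-filter⁻; ∈-cartesianProductWith⁺)
open import Data.List.Membership.DecPropositional using (_∈?_)
open import Data.List.Properties using (∷-injective; length-map; length-upTo)
open import Data.List.Relation.Binary.Permutation.Propositional
  using (_↭_; prep; ↭-refl; ↭-sym; ↭-trans)
open import Data.List.Relation.Binary.Permutation.Propositional.Properties
  using (∈-resp-↭; ↭-length; shift; drop-∷; ¬x∷xs↭[])
open import Data.List.Relation.Binary.Sublist.Propositional using (_⊆_; []; _∷_; _∷ʳ_)
open import Data.List.Relation.Unary.All as All using (All)
open import Data.List.Relation.Unary.Any using (here)
open import Data.List.Relation.Unary.Unique.Propositional using (Unique; []; _∷_)
import Data.List.Relation.Unary.Unique.Propositional.Properties as Unique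
open import Data.Nat.Base as ℕ using (ℕ; zero; suc; _<_; _∸_)
import Data.Nat.Properties as ℕ
open import Data.Product.Base using (Σ; ∃; _×_; _,_; proj₁; proj₂)
open import Data.Sum.Base using (_⊎_; inj₁; inj₂; [_,_]′)
open import Function.Base using (_∘_)
open import Function.Bundles using (_⇔_; mk⇔; Equivalence)
open import Relation.Binary.PropositionalEquality
  using (_≡_; refl; trans; cong; subst; _≗_; module ≡-Reasoning)
open import Relation.Nullary.Decidable
  using (Dec; yes; no; map′; True; toWitness; ¬?; _×-dec_; _⊎-dec_; _→-dec_)
open import Relation.Nullary.Negation using (¬_)
open import Relation.Unary using (Decidable)

open import Algebra.Properties.Monoid.Sum ℤ.+-0-monoid using (sum⁺-syntax)

-- Permutations of {1, …, n} and patterns, in one-line notation.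
Word : Set
Word = List ℕ

[1⋯_] : ℕ → Word
[1⋯ n ] = map suc (upTo n)

OrderIsomorphic : Word → Word → Set
OrderIsomorphic σ τ =
  Σ (length σ ≡ length τ) λ eq → ∀ (i j : Fin (length σ)) →
    lookup σ i < lookup σ j ⇔ lookup τ (cast eq i) < lookup τ (cast eq j)

Contains : Word → Word → Set
Contains π τ = ∃ λ σ → σ ⊆ π × OrderIsomorphic σ τ

Avoids : Word → Word → Set
Avoids π τ = ¬ Contains π τ

S : ℕ → List Word → Word → Set
S n T π = π ↭ [1⋯ n ] × All (Avoids π) T

orderIsomorphic? : ∀ σ τ → Dec (OrderIsomorphic σ τ)
orderIsomorphic? σ τ with length σ ℕ.≟ length τ
... | no  neq = no (neq ∘ proj₁)
... | yes eq  = map′ (eq ,_) proj₂ (all? λ i → all? λ j →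
        (lookup σ i ℕ.<? lookup σ j) ⇔-dec
        (lookup τ (cast eq i) ℕ.<? lookup τ (cast eq j)))
  where
  _⇔-dec_ : ∀ {A B : Set} → Dec A → Dec B → Dec (A ⇔ B)
  a? ⇔-dec b? =
    map′ (λ (f , g) → mk⇔ f g) (λ e → Equivalence.to e , Equivalence.from e)
      ((a? →-dec b?) ×-dec (b? →-dec a?))

anySublist? : ∀ {P : Word → Set} → Decidable P →
              ∀ π → Dec (∃ λ σ → σ ⊆ π × P σ)
anySublist? P? [] =
  map′ (λ p → [] , [] , p) (λ { (_ , [] , p) → p }) (P? [])
anySublist? {P} P? (x ∷ π) =
  map′ [ (λ (σ , s , p) → σ , x ∷ʳ s , p)
       , (λ (σ , s , p) → x ∷ σ , refl ∷ s , p) ]′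
       split
       (anySublist? P? π ⊎-dec anySublist? (P? ∘ (x ∷_)) π)
  where
  split : (∃ λ σ → σ ⊆ x ∷ π × P σ) →
          (∃ λ σ → σ ⊆ π × P σ) ⊎ (∃ λ σ → σ ⊆ π × P (x ∷ σ))
  split (σ , _ ∷ʳ s , p)        = inj₁ (σ , s , p)
  split (_ ∷ σ , refl ∷ s , p) = inj₂ (σ , s , p)

avoids? : ∀ π τ → Dec (Avoids π τ)
avoids? π τ = ¬? (anySublist? (λ σ → orderIsomorphic? σ τ) π)

_↭?_ : (xs ys : Word) → Dec (xs ↭ ys)
[] ↭? []       = yes ↭-refl
[] ↭? (y ∷ ys) = no (¬x∷xs↭[] ∘ ↭-sym)
(x ∷ xs) ↭? ys with _∈?_ ℕ._≟_ x ys
... | no x∉ys = no λ p → x∉ys (∈-resp-↭ p (here refl))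
... | yes x∈ys with ∈-∃++ x∈ys
...   | as , bs , refl =
        map′ (λ p → ↭-trans (prep x p) (↭-sym (shift x as bs)))
             (λ p → drop-∷ (↭-trans p (shift x as bs)))
             (xs ↭? (as ++ bs))

S? : ∀ n T → Decidable (S n T)
S? n T π = (π ↭? [1⋯ n ]) ×-dec All.all? (avoids? π) T

words : ℕ → List ℕ → List Word
words zero    as = [] ∷ []
words (suc k) as = cartesianProductWith _∷_ as (words k as)

elements : ℕ → List Word → List Word
elements n T = filter (S? n T) (words n [1⋯ n ])

∣S∣ : ℕ → List Word → ℕ
∣S∣ n T = length (elements n T)

-- elements-unique and ∈-elements below show that elements n T lists the
-- members of S n T without repetition, so ∣S∣ n T is their number.

words-unique : ∀ k {as} → Unique as → Unique (words k as)
words-unique zero    u = All.[] ∷ []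
words-unique (suc k) u =
  Unique.cartesianProductWith⁺ _∷_ ∷-injective u (words-unique k u)

elements-unique : ∀ n T → Unique (elements n T)
elements-unique n T = Unique.filter⁺ (S? n T)
  (words-unique n (Unique.map⁺ ℕ.suc-injective (Unique.upTo⁺ n)))

∈-words : ∀ {as} π → All (_∈ as) π → π ∈ words (length π) as
∈-words []      _              = here refl
∈-words (x ∷ π) (x∈as All.∷ p) = ∈-cartesianProductWith⁺ _∷_ x∈as (∈-words π p)

∈-elements : ∀ n T π → π ∈ elements n T ⇔ S n T π
∈-elements n T π = mk⇔ (λ m → proj₂ (∈-filter⁻ (S? n T) {xs = words n [1⋯ n ]} m)) from
  where
  from : S n T π → π ∈ elements n T
  from s@(p , _) = ∈-filter⁺ (S? n T)
    (subst (λ k → π ∈ words k [1⋯ n ])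
      (trans (↭-length p) (trans (length-map suc (upTo n)) (length-upTo n)))
      (∈-words π (All.tabulate (∈-resp-↭ p))))
    s

-- A series is its coefficient sequence; equality of series is _≗_.
Series : Set
Series = ℕ → ℤ

-- The polynomial with the given coefficients, constant term first.
poly : List ℤ → Series
poly []       n       = 0ℤ
poly (a ∷ as) zero    = a
poly (a ∷ as) (suc n) = poly as n

infixl 7 _⊛_ _/_

_⊛_ : Series → Series → Series
(f ⊛ g) n = ∑[ i ≤ n ] (f (toℕ i) ℤ.* g (n ∸ toℕ i))

-- Long division: if g = 1 + x g′ and f = f₀ + x f′ then
-- f / g = f₀ + x ((f′ - f₀ g′) / g).
_/_ : (f g : Series) → {True (g 0 ℤ.≟ 1ℤ)} → Series
((f / g) {_})  zero    = f 0
((f / g) {g₀}) (suc n) = ((λ k → f (suc k) ℤ.- f 0 ℤ.* g (suc k)) / g) {g₀} n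

-- By /-⊛ and /-unique, f / g is the unique series whose product with g is f.

/-⊛ : ∀ f g {g₀} → (f / g) {g₀} ⊛ g ≗ f
/-⊛ f g {g₀} zero = begin
  f 0 ℤ.* g 0 ℤ.+ 0ℤ  ≡⟨ ℤ.+-identityʳ _ ⟩
  f 0 ℤ.* g 0         ≡⟨ cong (f 0 ℤ.*_) (toWitness g₀) ⟩
  f 0 ℤ.* 1ℤ          ≡⟨ ℤ.*-identityʳ _ ⟩
  f 0                 ∎
  where open ≡-Reasoning
/-⊛ f g {g₀} (suc n) = begin
  c ℤ.+ ((f′ / g) {g₀} ⊛ g) n   ≡⟨ cong (λ a → c ℤ.+ a) (/-⊛ f′ g {g₀} n) ⟩
  c ℤ.+ (f (suc n) ℤ.- c)       ≡⟨ ℤ.+-comm c _ ⟩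
  f (suc n) ℤ.- c ℤ.+ c         ≡⟨ ℤ.+-assoc (f (suc n)) (ℤ.- c) c ⟩
  f (suc n) ℤ.+ (ℤ.- c ℤ.+ c)   ≡⟨ cong (λ a → f (suc n) ℤ.+ a) (ℤ.+-inverseˡ c) ⟩
  f (suc n) ℤ.+ 0ℤ              ≡⟨ ℤ.+-identityʳ _ ⟩
  f (suc n)                     ∎
  where
  open ≡-Reasoning
  c : ℤ
  c = f 0 ℤ.* g (suc n)
  f′ : Series
  f′ k = f (suc k) ℤ.- f 0 ℤ.* g (suc k)

/-unique : ∀ f g h {g₀} → h ⊛ g ≗ f → h ≗ (f / g) {g₀}
/-unique f g h {g₀} eq zero = begin
  h 0                 ≡⟨ ℤ.*-identityʳ _ ⟨
  h 0 ℤ.* 1ℤ          ≡⟨ cong (h 0 ℤ.*_) (toWitness g₀) ⟨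
  h 0 ℤ.* g 0         ≡⟨ ℤ.+-identityʳ _ ⟨
  h 0 ℤ.* g 0 ℤ.+ 0ℤ  ≡⟨ eq 0 ⟩
  f 0                 ∎
  where open ≡-Reasoning
/-unique f g h {g₀} eq (suc n) = /-unique f′ g (h ∘ suc) {g₀} eq′ n
  where
  open ≡-Reasoning
  f′ : Series
  f′ k = f (suc k) ℤ.- f 0 ℤ.* g (suc k)
  eq′ : (h ∘ suc) ⊛ g ≗ f′
  eq′ k = begin
    r                                ≡⟨ ℤ.+-identityʳ r ⟨
    r ℤ.+ 0ℤ                         ≡⟨ cong (λ a → r ℤ.+ a) (ℤ.+-inverseʳ c) ⟨
    r ℤ.+ (c ℤ.- c)                  ≡⟨ ℤ.+-assoc r c (ℤ.- c) ⟨
    r ℤ.+ c ℤ.- c                    ≡⟨ cong (ℤ._- c) (ℤ.+-comm r c) ⟩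
    c ℤ.+ r ℤ.- c                    ≡⟨ cong (ℤ._- c) (eq (suc k)) ⟩
    f (suc k) ℤ.- c                  ≡⟨ cong (λ a → f (suc k) ℤ.- a ℤ.* g (suc k)) (/-unique f g h {g₀} eq 0) ⟩
    f (suc k) ℤ.- f 0 ℤ.* g (suc k)  ∎
    where
    c r : ℤ
    c = h 0 ℤ.* g (suc k)
    r = ((h ∘ suc) ⊛ g) k

F : List Word → Series
F T n = + ∣S∣ n T

{-# OPTIONS --safe #-}

-- Peel off harmless letters. Let A n be the set of avoiders of length n. A first
-- letter that is 1 or the maximum is irrelevant and can be deleted; B is what
-- remains of A without the first kind, M what remains without both kinds.
-- An avoider in M with maximum N either ends in N, or has N in second place behind
-- a letter other than N - 1 (delete N in both cases), or lies in the set C of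
-- avoiders that start with N - 1 and do not end in N. Indeed, if N is neither last
-- nor among the first two letters, comparing the first two letters with N, 1, N - 1
-- and a letter after N shows that they are N - 1 and 1. The same comparison
-- in C leaves N (delete the first two letters) or 1 (delete it and stay in C) as
-- second letter. Eliminating B, M and C from the resulting linear system gives
-- aₙ₊₃ = 5 aₙ₊₂ - 6 aₙ₊₁ + 3 aₙ for n ≥ 1.

module Submission where

open import Defs
open import Data.Empty using (⊥-elim)
open import Data.Fin.Base using (Fin; zero; suc; cast)
open import Data.Integer.Base as ℤ using (+_; -_; 0ℤ)
import Data.Integer.Properties as ℤ
open import Data.Integer.Tactic.RingSolver using () renaming (solve-∀ to ℤ-solve-∀)
open import Data.List.Base using (List; []; _∷_; _++_; length; map; upTo; lookup; head)
open import Data.List.Membership.Propositional using (_∈_; _∉_)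
open import Data.List.Membership.Propositional.Properties
  using (∈-map⁺; ∈-map⁻; ∈-upTo⁺; ∈-upTo⁻; ∈-++⁺ˡ; ∈-++⁺ʳ; ∈-++⁻; ∈-∃++; ∈-insert)
open import Data.List.Membership.Propositional.Properties.WithK using (unique∧set⇒bag)
open import Data.List.Properties
  using (length-map; length-++; length-upTo; map-++; map-upTo; map-injective; upTo-∷ʳ;
    ∷-injectiveˡ; ∷-injectiveʳ; ++-identityʳ; ++-cancelʳ)
open import Data.List.Relation.Binary.BagAndSetEquality using (∼bag⇒↭)
open import Data.List.Relation.Binary.Permutation.Propositional
  using (_↭_; prep; swap; ↭-refl; ↭-sym; ↭-trans; ↭-reflexive; ↭⇒↭ₛ)
open import Data.List.Relation.Binary.Permutation.Propositional.Properties
  using (∈-resp-↭; ↭-length; shift; drop-∷; ∷↭∷ʳ; ↭-map-inv) renaming (map⁺ to ↭-map⁺)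
open import Data.List.Relation.Binary.Permutation.Setoid.Properties using (Unique-resp-↭)
open import Data.List.Relation.Binary.Sublist.Propositional
  using (_⊆_; []; _∷_; _∷ʳ_; ⊆-refl; ⊆-trans; minimum; from∈) renaming (lookup to ⊆-lookup)
open import Data.List.Relation.Binary.Sublist.Propositional.Properties
  using (∷⁻; ∷ˡ⁻; ∷ʳ⁻; ++⁺ˡ; All-resp-⊆) renaming (map⁺ to ⊆-map⁺)
open import Data.List.Relation.Unary.All as All using (All; []; _∷_)
open import Data.List.Relation.Unary.AllPairs using ([]; _∷_)
open import Data.List.Relation.Unary.Any using (here; there)
open import Data.List.Relation.Unary.Unique.Propositional using (Unique)
import Data.List.Relation.Unary.Unique.Propositional.Properties as Unique
open import Data.Maybe.Base using (just)
open import Data.Maybe.Properties using (just-injective)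
open import Data.Nat.Base using (ℕ; zero; suc; _+_; _*_; _<_; _≤_; s≤s; z<s; s<s; s≤s⁻¹; s<s⁻¹)
open import Data.Nat.Properties
  using (_≟_; ≤∧≢⇒<; ≮⇒≥; <⇒≱; ≤⇒≯; <⇒≤; <⇒≢; <-irrefl; <-trans; <-asym; <-cmp; ≤-refl;
    ≤-antisym; ≤-<-trans; n<1+n; 1+n≢n; m<n⇒m<1+n; m≤n⇒m<n∨m≡n; suc-injective)
open import Data.Nat.Tactic.RingSolver using (solve-∀)
open import Data.Product.Base using (∃; ∃₂; _×_; _,_; proj₁; proj₂)
open import Data.Sum.Base as Sum using (_⊎_; inj₁; inj₂)
open import Function.Base using (_∘_; id)
open import Function.Bundles using (_⇔_; mk⇔; Equivalence)
open import Relation.Binary.Definitions using (tri<; tri≈; tri>)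
open import Relation.Binary.PropositionalEquality
  using (_≡_; _≢_; _≗_; refl; sym; trans; cong; cong₂; subst; setoid; module ≡-Reasoning)
open import Relation.Nullary.Decidable using (yes; no)
open import Relation.Nullary.Negation using (¬_; contradiction)

open Equivalence using (to; from)

-- Enumerated sets of words

record Count (P : Word → Set) (k : ℕ) : Set where
  field
    list    : List Word
    unique  : Unique list
    members : ∀ w → w ∈ list ⇔ P w
    size    : length list ≡ k

open Count

-- Duplicate-free lists with the same members are permutations of each other. This lets the size
-- obtained by filtering all words be replaced by one built recursively.
count-unique : ∀ {P j k} → Count P j → Count P k → j ≡ k
count-unique c d = trans (sym (size c)) (trans (↭-length (∼bag⇒↭
    (unique∧set⇒bag (unique c) (unique d)
      (λ {w} → mk⇔ (from (members d w) ∘ to (members c w))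
                   (from (members c w) ∘ to (members d w)))))) (size d))

count-∅ : ∀ {P} → (∀ w → ¬ P w) → Count P 0
count-∅ ¬P = record
  { list = [] ; unique = [] ; size = refl
  ; members = λ w → mk⇔ (λ ()) (⊥-elim ∘ ¬P w) }

count-⊎ : ∀ {P Q R j k} → Count P j → Count Q k → (∀ w → P w → ¬ Q w) →
          (∀ w → R w ⇔ (P w ⊎ Q w)) → Count R (j + k)
count-⊎ c d disjoint split = record
  { list    = list c ++ list d
  ; unique  = Unique.++⁺ (unique c) (unique d)
      (λ {w} (i , j) → disjoint w (to (members c w) i) (to (members d w) j))
  ; members = λ w → mk⇔
      (from (split w) ∘ Sum.map (to (members c w)) (to (members d w)) ∘ ∈-++⁻ (list c))
      (Sum.[ ∈-++⁺ˡ ∘ from (members c w) , ∈-++⁺ʳ (list c) ∘ from (members d w) ] ∘ to (split w))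
  ; size    = trans (length-++ (list c)) (cong₂ _+_ (size c) (size d))
  }

Image : (Word → Word) → (Word → Set) → Word → Set
Image f P w = ∃ λ v → P v × w ≡ f v

count-image : ∀ {P k f} → (∀ {v w} → f v ≡ f w → v ≡ w) → Count P k → Count (Image f P) k
count-image {P} {f = f} inj c = record
  { list    = map f (list c)
  ; unique  = Unique.map⁺ inj (unique c)
  ; members = λ w → mk⇔ (image w) (preimage w)
  ; size    = trans (length-map f (list c)) (size c)
  }
  where
  image : ∀ w → w ∈ map f (list c) → Image f P w
  image w w∈ with v , v∈ , refl ← ∈-map⁻ f w∈ = v , to (members c v) v∈ , refl
  preimage : ∀ w → Image f P w → w ∈ map f (list c)
  preimage w (v , p , refl) = ∈-map⁺ f (from (members c v) p)

-- Permutations and sublists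

Perm : ℕ → Word → Set
Perm n π = π ↭ [1⋯ n ]

[1⋯suc] : ∀ n → [1⋯ suc n ] ≡ 1 ∷ map suc [1⋯ n ]
[1⋯suc] n = cong (λ xs → 1 ∷ map suc xs) (sym (map-upTo suc n))

[1⋯n]∷ʳ : ∀ n → suc n ∷ [1⋯ n ] ↭ [1⋯ suc n ]
[1⋯n]∷ʳ n = ↭-trans (∷↭∷ʳ (suc n) [1⋯ n ])
  (↭-reflexive (trans (sym (map-++ suc (upTo n) (n ∷ []))) (cong (map suc) (upTo-∷ʳ n))))

module _ {n π} (p : Perm n π) where

  perm-∈ : ∀ {i} → i < n → suc i ∈ π
  perm-∈ i<n = ∈-resp-↭ (↭-sym p) (∈-map⁺ suc (∈-upTo⁺ i<n))

  perm-bounds : ∀ {x} → x ∈ π → 0 < x × x ≤ n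
  perm-bounds x∈ with i , i∈ , refl ← ∈-map⁻ suc (∈-resp-↭ p x∈) = z<s , ∈-upTo⁻ i∈

  perm-unique : Unique π
  perm-unique = Unique-resp-↭ (setoid ℕ) (↭⇒↭ₛ (↭-sym p))
    (Unique.map⁺ suc-injective (Unique.upTo⁺ n))

  perm-length : length π ≡ n
  perm-length = trans (↭-length p) (trans (length-map suc (upTo n)) (length-upTo n))

perm-shift : ∀ {n π} → Perm n π → Perm (suc n) (1 ∷ map suc π)
perm-shift {n} p = ↭-trans (prep 1 (↭-map⁺ suc p)) (↭-reflexive (sym ([1⋯suc] n)))

perm-unshift : ∀ {n π} → Perm (suc n) (1 ∷ π) → ∃ λ π′ → Perm n π′ × π ≡ map suc π′
perm-unshift {n} p
  with π′ , eq , q ← ↭-map-inv suc (↭-sym (drop-∷ (↭-trans p (↭-reflexive ([1⋯suc] n)))))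
  = π′ , ↭-sym q , eq

perm-insert : ∀ {n} xs {ys} → Perm n (xs ++ ys) → Perm (suc n) (xs ++ suc n ∷ ys)
perm-insert {n} xs p = ↭-trans (shift (suc n) xs _) (↭-trans (prep (suc n) p) ([1⋯n]∷ʳ n))

perm-delete : ∀ {n} xs {ys} → Perm (suc n) (xs ++ suc n ∷ ys) → Perm n (xs ++ ys)
perm-delete {n} xs p = drop-∷ (↭-trans (↭-sym (shift (suc n) xs _)) (↭-trans p (↭-sym ([1⋯n]∷ʳ n))))

unique-⊆ : ∀ {σ π : Word} → σ ⊆ π → Unique π → Unique σ
unique-⊆ []         u       = u
unique-⊆ (y ∷ʳ s)   (_ ∷ u) = unique-⊆ s u
unique-⊆ (refl ∷ s) (x ∷ u) = All-resp-⊆ s x ∷ unique-⊆ s u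

⊆-map-inv : ∀ (f : ℕ → ℕ) {σ} π → σ ⊆ map f π → ∃ λ σ′ → σ ≡ map f σ′ × σ′ ⊆ π
⊆-map-inv f []      []         = [] , refl , []
⊆-map-inv f (x ∷ π) (_ ∷ʳ s)   with σ′ , refl , s′ ← ⊆-map-inv f π s = σ′ , refl , x ∷ʳ s′
⊆-map-inv f (x ∷ π) (refl ∷ s) with σ′ , refl , s′ ← ⊆-map-inv f π s = x ∷ σ′ , refl , refl ∷ s′

⊆-delete : ∀ {v : ℕ} {σ} xs {ys} → σ ⊆ xs ++ v ∷ ys → v ∉ σ → σ ⊆ xs ++ ys
⊆-delete []       (_ ∷ʳ s)   v∉ = s
⊆-delete []       (refl ∷ s) v∉ = contradiction (here refl) v∉
⊆-delete (x ∷ xs) (_ ∷ʳ s)   v∉ = x ∷ʳ ⊆-delete xs s v∉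
⊆-delete (x ∷ xs) (refl ∷ s) v∉ = refl ∷ ⊆-delete xs s (v∉ ∘ there)

-- The displayed `v` is the only one in the longer word, so the `v` of the sublist can only be
-- matched with it.
⊆-split : ∀ {v : ℕ} zs {ws} xs {ys} → v ∉ xs ++ ys →
          zs ++ v ∷ ws ⊆ xs ++ v ∷ ys → zs ⊆ xs × ws ⊆ ys
⊆-split []       []       v∉ (_ ∷ʳ s)   = contradiction (⊆-lookup s (here refl)) v∉
⊆-split []       []       v∉ (refl ∷ s) = [] , s
⊆-split (_ ∷ zs) []       v∉ s          = contradiction (⊆-lookup (∷⁻ s) (∈-insert zs)) v∉
⊆-split []       (x ∷ xs) v∉ (_ ∷ʳ s)   with a , b ← ⊆-split [] xs (v∉ ∘ there) s = x ∷ʳ a , b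
⊆-split []       (x ∷ xs) v∉ (refl ∷ s) = contradiction (here refl) v∉
⊆-split (z ∷ zs) (x ∷ xs) v∉ (_ ∷ʳ s)   with a , b ← ⊆-split (z ∷ zs) xs (v∉ ∘ there) s = x ∷ʳ a , b
⊆-split (z ∷ zs) (x ∷ xs) v∉ (refl ∷ s) with a , b ← ⊆-split zs xs (v∉ ∘ there) s = refl ∷ a , b

-- Applied below with `m` the maximum of a permutation, to place a given value `v` before or after
-- it.
⊆-locate : ∀ {m r v : ℕ} {π} → (m ∷ r ∷ []) ⊆ π → v ∈ π → v ≢ m →
           (v ∷ m ∷ r ∷ []) ⊆ π ⊎ (m ∷ v ∷ []) ⊆ π
⊆-locate (_ ∷ʳ s)   (here refl) v≢m = inj₁ (refl ∷ s)
⊆-locate (y ∷ʳ s)   (there i)   v≢m = Sum.map (y ∷ʳ_) (y ∷ʳ_) (⊆-locate s i v≢m)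
⊆-locate (refl ∷ s) (here v≡m)  v≢m = contradiction v≡m v≢m
⊆-locate (refl ∷ s) (there i)   v≢m = inj₂ (refl ∷ from∈ i)

-- Avoidance expressed by inequalities between letters

-- For distinct letters, the second constructor covers both 2341 and 3241.
data Forbidden (a b c d : ℕ) : Set where
  2143-like : b < a → a < d → d < c → Forbidden a b c d
  xx41-like : d < a → d < b → a < c → b < c → Forbidden a b c d

Good : Word → Set
Good π = ∀ {a b c d} → (a ∷ b ∷ c ∷ d ∷ []) ⊆ π → ¬ Forbidden a b c d

good-⊆ : ∀ {ρ π} → ρ ⊆ π → Good π → Good ρ
good-⊆ s g t = g (⊆-trans t s)

good-map-suc⁺ : ∀ {π} → Good π → Good (map suc π)
good-map-suc⁺ {π} g s f with _ ∷ _ ∷ _ ∷ _ ∷ [] , refl , t ← ⊆-map-inv suc π s = g t (unsuc f)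
  where
  unsuc : ∀ {a b c d} → Forbidden (suc a) (suc b) (suc c) (suc d) → Forbidden a b c d
  unsuc (2143-like p q r)   = 2143-like (s<s⁻¹ p) (s<s⁻¹ q) (s<s⁻¹ r)
  unsuc (xx41-like p q r s) = xx41-like (s<s⁻¹ p) (s<s⁻¹ q) (s<s⁻¹ r) (s<s⁻¹ s)

good-map-suc⁻ : ∀ {π} → Good (map suc π) → Good π
good-map-suc⁻ g s = g (⊆-map⁺ suc s) ∘ suc′
  where
  suc′ : ∀ {a b c d} → Forbidden a b c d → Forbidden (suc a) (suc b) (suc c) (suc d)
  suc′ (2143-like p q r)   = 2143-like (s<s p) (s<s q) (s<s r)
  suc′ (xx41-like p q r s) = xx41-like (s<s p) (s<s q) (s<s r) (s<s s)

-- A maximal letter can only play the role of the 4.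
good-insert : ∀ {m} xs {ys} → All (_< m) (xs ++ ys) → Good (xs ++ ys) →
              (∀ {a b d} → (a ∷ b ∷ []) ⊆ xs → ¬ (d ∷ []) ⊆ ys) →
              Good (xs ++ m ∷ ys)
good-insert {m} xs {ys} xs++ys<m g safe {a} {b} {c} {d} s f with m ≟ c
... | yes refl = let (s₁ , s₂) = ⊆-split (a ∷ b ∷ []) xs m∉ s in safe s₁ s₂
  where
  m∉ : m ∉ xs ++ ys
  m∉ m∈ = <-irrefl refl (All.lookup xs++ys<m m∈)
... | no m≢c = g (⊆-delete xs s m∉) f
  where
  bound : ∀ {x} → x ∈ xs ++ m ∷ ys → x ≤ m
  bound x∈ with ∈-++⁻ xs x∈
  ... | inj₁ i           = <⇒≤ (All.lookup xs++ys<m (∈-++⁺ˡ i))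
  ... | inj₂ (here refl) = ≤-refl
  ... | inj₂ (there i)   = <⇒≤ (All.lookup xs++ys<m (∈-++⁺ʳ xs i))
  c≤m : c ≤ m
  c≤m = bound (⊆-lookup s (there (there (here refl))))
  below : Forbidden a b c d → a < c × b < c × d < c
  below (2143-like b<a a<d d<c)   = <-trans a<d d<c , <-trans b<a (<-trans a<d d<c) , d<c
  below (xx41-like d<a _ a<c b<c) = a<c , b<c , <-trans d<a a<c
  m∉ : m ∉ a ∷ b ∷ c ∷ d ∷ []
  m∉ m∈ with a<c , b<c , d<c ← below f with m∈
  ... | here refl                         = <⇒≱ a<c c≤m
  ... | there (here refl)                 = <⇒≱ b<c c≤m
  ... | there (there (here m≡c))          = m≢c m≡c
  ... | there (there (there (here refl))) = <⇒≱ d<c c≤m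

-- Avoiding permutations: inserting and deleting extreme letters

A : ℕ → Word → Set
A n π = Perm n π × Good π

-- An occurrence with the new maximum as its 4 needs two letters before it and one after it. In
-- every application `xs` has at most one letter or `ys` is empty.
A-insert : ∀ {n} xs {ys} → (∀ {a b d} → (a ∷ b ∷ []) ⊆ xs → ¬ (d ∷ []) ⊆ ys) →
           A n (xs ++ ys) → A (suc n) (xs ++ suc n ∷ ys)
A-insert xs safe (p , g) =
  perm-insert xs p , good-insert xs (All.tabulate (s≤s ∘ proj₂ ∘ perm-bounds p)) g safe

A-delete : ∀ {n} xs {ys} → A (suc n) (xs ++ suc n ∷ ys) → A n (xs ++ ys)
A-delete {n} xs {ys} (p , g) = perm-delete xs p , good-⊆ (skip xs) g
  where
  skip : ∀ xs → xs ++ ys ⊆ xs ++ suc n ∷ ys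
  skip []       = _ ∷ʳ ⊆-refl
  skip (x ∷ xs) = refl ∷ skip xs

-- In each forbidden shape the first letter lies above a later one, so a leading 1 belongs to no
-- occurrence.
A-shift : ∀ {n π} → A n π → A (suc n) (1 ∷ map suc π)
A-shift {n} {π} (p , g) = perm-shift p , good
  where
  good : Good (1 ∷ map suc π)
  good (_ ∷ʳ s)   f = good-map-suc⁺ g s f
  good (refl ∷ s) f with _ ∷ _ ∷ _ ∷ [] , refl , _ ← ⊆-map-inv suc π s with f
  ... | 2143-like (s≤s ()) _ _
  ... | xx41-like (s≤s ()) _ _ _

A-unshift : ∀ {n π} → A (suc n) (1 ∷ π) → ∃ λ π′ → A n π′ × π ≡ map suc π′
A-unshift (p , g) with π′ , q , refl ← perm-unshift p = π′ , (q , good-map-suc⁻ (good-⊆ (_ ∷ʳ ⊆-refl) g)) , refl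

-- The values 1 and `1 + m` are located relative to the maximum. Every placement except the claimed
-- one creates a forbidden occurrence or leaves no value for `x`.
two-before-max : ∀ {m x z ρ r} → Perm (2 + m) (x ∷ z ∷ ρ) → Good (x ∷ z ∷ ρ) →
  x ≢ 1 → x ≢ 2 + m → z ≢ 2 + m → (2 + m ∷ r ∷ []) ⊆ ρ →
  x ≡ 1 + m × z ≡ 1
two-before-max {m} {x} {z} {ρ} {r} p g x≢1 x≢N z≢N s = cases
  where
  π = x ∷ z ∷ ρ
  N = 2 + m
  x∈ : x ∈ π
  x∈ = here refl
  z∈ : z ∈ π
  z∈ = there (here refl)
  above-1 : ∀ {y} → y ∈ π → y ≢ 1 → 1 < y
  above-1 y∈ y≢1 = ≤∧≢⇒< (proj₁ (perm-bounds p y∈)) (y≢1 ∘ sym)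
  below-N : ∀ {y} → y ∈ π → y ≢ N → y < N
  below-N y∈ y≢N = ≤∧≢⇒< (proj₂ (perm-bounds p y∈)) y≢N
  after-N : ∀ {y} → (N ∷ y ∷ []) ⊆ π → y < N
  after-N t with (N≢y ∷ []) ∷ _ ← unique-⊆ t (perm-unique p) =
    below-N (⊆-lookup t (there (here refl))) (N≢y ∘ sym)
  -- If `r` were above `y`, then `y`, 1, `N`, `r` would be a 2143.
  below-head : ∀ {y r} → (y ∷ 1 ∷ N ∷ r ∷ []) ⊆ π → r < y
  below-head {y} t with (y≢1 ∷ _ ∷ y≢r ∷ []) ∷ _ ← unique-⊆ t (perm-unique p) =
    ≤∧≢⇒< (≮⇒≥ λ y<r → g t (2143-like (above-1 (⊆-lookup t (here refl)) y≢1) y<r (after-N (∷ˡ⁻ (∷ˡ⁻ t)))))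
          (y≢r ∘ sym)
  cases : x ≡ 1 + m × z ≡ 1
  cases with z ≟ 1
  cases | no z≢1 with perm-∈ p z<s
  ... | here 1≡x         = contradiction (sym 1≡x) x≢1
  ... | there (here 1≡z) = contradiction (sym 1≡z) z≢1
  ... | there (there 1∈) with ⊆-locate s 1∈ (λ ())
  -- With 1 between `z` and `N`, `below-head` applies to `x` and to `z`: both exceed `r`, and `x`,
  -- `z`, `N`, `r` is forbidden.
  ...   | inj₁ t = ⊥-elim (g (refl ∷ refl ∷ s) (xx41-like
                     (below-head (refl ∷ _ ∷ʳ t)) (below-head (_ ∷ʳ refl ∷ t))
                     (below-N x∈ x≢N) (below-N z∈ z≢N)))
  -- With 1 after `N`, the 1 itself ends the occurrence.
  ...   | inj₂ t = ⊥-elim (g (refl ∷ refl ∷ t) (xx41-like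
                     (above-1 x∈ x≢1) (above-1 z∈ z≢1)
                     (below-N x∈ x≢N) (below-N z∈ z≢N)))
  cases | yes refl with perm-∈ p (m<n⇒m<1+n (n<1+n m))
  ... | here 1+m≡x          = sym 1+m≡x , refl
  -- Here `1 + m` equals 1, so `N` is 2 and no value lies strictly between 1 and `N` for `x`.
  ... | there (here refl)   = contradiction (below-N x∈ x≢N) (≤⇒≯ (above-1 x∈ x≢1))
  ... | there (there 1+m∈) with ⊆-locate s 1+m∈ (<⇒≢ (n<1+n (1 + m)))
  -- With `1 + m` after `N`, `below-head` puts `x` above `1 + m`, hence not below `N`.
  ...   | inj₂ t = contradiction (below-N x∈ x≢N) (≤⇒≯ (below-head (refl ∷ refl ∷ t)))
  -- With `1 + m` before `N`, the occurrence is `x`, `1 + m`, `N`, `r`.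
  ...   | inj₁ t with (_ ∷ 1+m≢r ∷ []) ∷ _ ← unique-⊆ (_ ∷ʳ _ ∷ʳ t) (perm-unique p) =
    ⊥-elim (g (refl ∷ _ ∷ʳ t) (xx41-like
      (below-head (refl ∷ refl ∷ s))
      (≤∧≢⇒< (s≤s⁻¹ (after-N (_ ∷ʳ _ ∷ʳ s))) (1+m≢r ∘ sym))
      (below-N x∈ x≢N) (n<1+n _)))

-- Equivalence with pattern avoidance

strict-mono : ∀ (g : ℕ → ℕ) → (∀ k → g k < g (suc k)) → ∀ {i j} → i < j → g i < g j
strict-mono g step {i} {suc j} i<1+j with m≤n⇒m<n∨m≡n (s≤s⁻¹ i<1+j)
... | inj₁ i<j  = <-trans (strict-mono g step i<j) (step j)
... | inj₂ refl = step i

-- Here `τ` lists the pattern's ranks counted from 0, and `g` sends each rank to the letter holding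
-- it. A strictly increasing `g` also reflects the order.
orderIsomorphic-map : ∀ (g : ℕ → ℕ) → (∀ {i j} → i < j → g i < g j) →
                      ∀ τ → OrderIsomorphic (map g τ) (map suc τ)
orderIsomorphic-map g mono τ = eq , λ i j → iso (values τ eq i) (values τ eq j)
  where
  eq : length (map g τ) ≡ length (map suc τ)
  eq = trans (length-map g τ) (sym (length-map suc τ))
  values : ∀ τ eq (i : Fin (length (map g τ))) →
           ∃ λ v → lookup (map g τ) i ≡ g v × lookup (map suc τ) (cast eq i) ≡ suc v
  values (v ∷ τ) eq zero    = v , refl , refl
  values (v ∷ τ) eq (suc i) = values τ (suc-injective eq) i
  reflect : ∀ {v w} → g v < g w → v < w
  reflect {v} {w} gv<gw with <-cmp v w
  ... | tri< v<w _ _  = v<w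
  ... | tri≈ _ refl _ = contradiction gv<gw (<-irrefl refl)
  ... | tri> _ _ w<v  = contradiction gv<gw (<-asym (mono w<v))
  iso : ∀ {x y x′ y′} → (∃ λ v → x ≡ g v × x′ ≡ suc v) → (∃ λ w → y ≡ g w × y′ ≡ suc w) →
        x < y ⇔ x′ < y′
  iso (v , refl , refl) (w , refl , refl) = mk⇔ (s<s ∘ reflect) (mono ∘ s<s⁻¹)

-- Four letters in increasing order, indexed by rank. The values continue upwards from `z` so that
-- the sequence is strictly increasing on all of ℕ, as `orderIsomorphic-map` demands.
chain : ℕ → ℕ → ℕ → ℕ → ℕ → ℕ
chain w x y z 0                   = w
chain w x y z 1                   = x
chain w x y z 2                   = y
chain w x y z (suc (suc (suc k))) = k + z

chain-mono : ∀ {w x y z} → w < x → x < y → y < z →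
             ∀ {i j} → i < j → chain w x y z i < chain w x y z j
chain-mono {w} {x} {y} {z} w<x x<y y<z = strict-mono (chain w x y z) λ
  { 0 → w<x ; 1 → x<y ; 2 → y<z ; (suc (suc (suc k))) → n<1+n (k + z) }

contains₄ : ∀ {π p q r s} → Contains π (p ∷ q ∷ r ∷ s ∷ []) → ∃₂ λ a b → ∃₂ λ c d →
  (a ∷ b ∷ c ∷ d ∷ []) ⊆ π ×
  OrderIsomorphic (a ∷ b ∷ c ∷ d ∷ []) (p ∷ q ∷ r ∷ s ∷ [])
contains₄ (a ∷ b ∷ c ∷ d ∷ [] , s , iso) = a , b , c , d , s , iso
contains₄ ([]                     , _ , () , _)
contains₄ (_ ∷ []                 , _ , () , _)
contains₄ (_ ∷ _ ∷ []             , _ , () , _)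
contains₄ (_ ∷ _ ∷ _ ∷ []         , _ , () , _)
contains₄ (_ ∷ _ ∷ _ ∷ _ ∷ _ ∷ _  , _ , () , _)

T : List Word
T = (2 ∷ 1 ∷ 4 ∷ 3 ∷ []) ∷ (2 ∷ 3 ∷ 4 ∷ 1 ∷ []) ∷ (3 ∷ 2 ∷ 4 ∷ 1 ∷ []) ∷ []

pattern 1st = zero
pattern 2nd = suc zero
pattern 3rd = suc (suc zero)
pattern 4th = suc (suc (suc zero))

S⇔A : ∀ n π → S n T π ⇔ A n π
S⇔A n π = mk⇔
  (λ (p , avoid) → p , good p avoid)
  (λ (p , g) → p , av2143 g ∷ av2341 g ∷ av3241 g ∷ [])
  where
  1<2 : 1 < 2
  1<2 = n<1+n 1
  2<3 : 2 < 3
  2<3 = n<1+n 2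
  3<4 : 3 < 4
  3<4 = n<1+n 3
  av2143 : Good π → Avoids π (2 ∷ 1 ∷ 4 ∷ 3 ∷ [])
  av2143 g c with a , b , c , d , s , eq , iso ← contains₄ c =
    g s (2143-like (from (iso 2nd 1st) 1<2) (from (iso 1st 4th) 2<3) (from (iso 4th 3rd) 3<4))
  av2341 : Good π → Avoids π (2 ∷ 3 ∷ 4 ∷ 1 ∷ [])
  av2341 g c with a , b , c , d , s , eq , iso ← contains₄ c =
    g s (xx41-like d<a (<-trans d<a a<b) (<-trans a<b b<c) b<c)
    where
    d<a = from (iso 4th 1st) 1<2
    a<b = from (iso 1st 2nd) 2<3
    b<c = from (iso 2nd 3rd) 3<4
  av3241 : Good π → Avoids π (3 ∷ 2 ∷ 4 ∷ 1 ∷ [])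
  av3241 g c with a , b , c , d , s , eq , iso ← contains₄ c =
    g s (xx41-like (<-trans d<b b<a) d<b a<c (<-trans b<a a<c))
    where
    d<b = from (iso 4th 2nd) 1<2
    b<a = from (iso 2nd 1st) 2<3
    a<c = from (iso 1st 3rd) 3<4
  good : Perm n π → All (Avoids π) T → Good π
  good p (av ∷ _) {a} {b} {c} {d} s (2143-like b<a a<d d<c) =
    av (_ , s , orderIsomorphic-map (chain b a d c) (chain-mono b<a a<d d<c) (1 ∷ 0 ∷ 3 ∷ 2 ∷ []))
  -- The order of `a` and `b` decides between 2341 and 3241; a tie contradicts the distinctness of
  -- the letters.
  good p (_ ∷ av₁ ∷ av₂ ∷ []) {a} {b} {c} {d} s (xx41-like d<a d<b a<c b<c) with <-cmp a b
  ... | tri< a<b _ _ = av₁ (_ , s ,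
    orderIsomorphic-map (chain d a b c) (chain-mono d<a a<b b<c) (1 ∷ 2 ∷ 3 ∷ 0 ∷ []))
  ... | tri> _ _ b<a = av₂ (_ , s ,
    orderIsomorphic-map (chain d b a c) (chain-mono d<b b<a a<c) (2 ∷ 1 ∷ 3 ∷ 0 ∷ []))
  ... | tri≈ _ refl _ with (a≢a ∷ _) ∷ _ ← unique-⊆ s (perm-unique p) = a≢a refl

∣S∣-count : ∀ n → Count (A n) (∣S∣ n T)
∣S∣-count n = record
  { list    = elements n T
  ; unique  = elements-unique n T
  ; members = λ π → mk⇔
      (to (S⇔A n π) ∘ to (∈-elements n T π))
      (from (∈-elements n T π) ∘ from (S⇔A n π))
  ; size    = refl
  }

-- The sets `B`, `M`, `C` and their decompositions

B : ℕ → Word → Set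
B n π = A (suc n) π × head π ≢ just 1

-- The indices of `B`, `M` and `C` are offset from the word lengths so that each of the three sets
-- is empty at index 0.
M : ℕ → Word → Set
M n π = A (2 + n) π × head π ≢ just 1 × head π ≢ just (2 + n)

-- The subsequence 2 + n, y says that the maximum is not the last letter.
C : ℕ → Word → Set
C n π = A (2 + n) π × head π ≡ just (1 + n) × ∃ λ y → (2 + n ∷ y ∷ []) ⊆ π

-- The maximum occurs only once, at the very end, so nothing can be matched after it.
not-last : ∀ {n ρ y} → Perm (suc n) (ρ ++ suc n ∷ []) → ¬ (suc n ∷ y ∷ []) ⊆ ρ ++ suc n ∷ []
not-last {n} {ρ} p s with () ← proj₂ (⊆-split [] ρ
    (λ i → <-irrefl refl (proj₂ (perm-bounds (perm-delete ρ p) i))) s)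

¬Perm[] : ∀ {n} → ¬ Perm (suc n) []
¬Perm[] p with () ← perm-∈ p z<s

prepend-1 : Word → Word
prepend-1 ρ = 1 ∷ map suc ρ

prepend-1-injective : ∀ {v w} → prepend-1 v ≡ prepend-1 w → v ≡ w
prepend-1-injective = map-injective suc-injective ∘ ∷-injectiveʳ

-- The clause for `[]` is a default that keeps the map injective on all words, which `count-image`
-- requires.
insert-second : ℕ → Word → Word
insert-second m []      = []
insert-second m (x ∷ ρ) = x ∷ m ∷ ρ

insert-second-injective : ∀ {m v w} → insert-second m v ≡ insert-second m w → v ≡ w
insert-second-injective {v = []}    {[]}     eq   = refl
insert-second-injective {v = _ ∷ _} {_ ∷ _}  refl = refl

insert-1-second : Word → Word
insert-1-second []      = []
insert-1-second (x ∷ ρ) = suc x ∷ 1 ∷ map suc ρ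

insert-1-second-injective : ∀ {v w} → insert-1-second v ≡ insert-1-second w → v ≡ w
insert-1-second-injective {[]}    {[]}     eq = refl
insert-1-second-injective {x ∷ v} {y ∷ w}  eq = cong₂ _∷_
  (suc-injective (∷-injectiveˡ eq)) (prepend-1-injective (∷-injectiveʳ eq))

A-split : ∀ n π → A (suc n) π ⇔ (Image prepend-1 (A n) π ⊎ B n π)
A-split n π = mk⇔ (split π) Sum.[ (λ { (ρ , a , refl) → A-shift a }) , proj₁ ]
  where
  split : ∀ π → A (suc n) π → Image prepend-1 (A n) π ⊎ B n π
  split []      (p , _) = ⊥-elim (¬Perm[] p)
  split (x ∷ π) a with x ≟ 1
  ... | yes refl with ρ , a′ , refl ← A-unshift a = inj₁ (ρ , a′ , refl)
  ... | no x≢1 = inj₂ (a , x≢1 ∘ just-injective)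

B-split : ∀ n π → B (suc n) π ⇔ (Image (2 + n ∷_) (A (1 + n)) π ⊎ M n π)
B-split n π = mk⇔ (split π) Sum.[ merge , (λ (a , h≢1 , _) → a , h≢1) ]
  where
  split : ∀ π → B (suc n) π → Image (2 + n ∷_) (A (1 + n)) π ⊎ M n π
  split []      ((p , _) , _) = ⊥-elim (¬Perm[] p)
  split (x ∷ π) (a , h≢1) with x ≟ 2 + n
  ... | yes refl = inj₁ (π , A-delete [] a , refl)
  ... | no x≢N   = inj₂ (a , h≢1 , x≢N ∘ just-injective)
  merge : Image (2 + n ∷_) (A (1 + n)) π → B (suc n) π
  merge (ρ , a , refl) = A-insert [] (λ ()) a , λ ()

-- The cases are the positions of `N`: last, second, or later but not last.
M-split : ∀ n π → M (suc n) π ⇔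
          (Image (_++ 3 + n ∷ []) (B (suc n)) π ⊎ (Image (insert-second (3 + n)) (M n) π ⊎ C (suc n) π))
M-split n π = mk⇔ (split π) Sum.[ merge₁ , Sum.[ merge₂ , merge₃ ] ]
  where
  N = 3 + n
  split : ∀ π → M (suc n) π → Image (_++ N ∷ []) (B (suc n)) π ⊎ (Image (insert-second N) (M n) π ⊎ C (suc n) π)
  split []      ((p , _) , _) = ⊥-elim (¬Perm[] p)
  split (x ∷ π) (a@(p , g) , h≢1 , h≢N) with perm-∈ p (n<1+n (2 + n))
  ... | here refl = contradiction refl h≢N
  ... | there N∈ with ∈-∃++ N∈
  -- The shortened word may start with its own maximum, so it lies in `B` and not necessarily in
  -- `M`.
  ... | ρ , [] , refl = inj₁ (x ∷ ρ ,
    (subst (A (2 + n)) (++-identityʳ (x ∷ ρ)) (A-delete (x ∷ ρ) a) , h≢1) , refl)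
  -- Deleting `N` makes `2 + n` the maximum, and words of `M n` may not start with theirs. Hence a
  -- head `2 + n` sends the word to `C`.
  ... | [] , r ∷ ρ , refl with x ≟ 2 + n
  ...   | yes refl = inj₂ (inj₂ (a , refl , r , _ ∷ʳ refl ∷ refl ∷ minimum ρ))
  ...   | no x≢ = inj₂ (inj₁ (x ∷ r ∷ ρ , (A-delete (x ∷ []) a , h≢1 , x≢ ∘ just-injective) , refl))
  split (x ∷ π) (a@(p , g) , h≢1 , h≢N) | there N∈ | z ∷ ρ , r ∷ ρ′ , refl
    = inj₂ (inj₂ (a , cong just x≡ , r , _ ∷ʳ _ ∷ʳ s))
    where
    s : (N ∷ r ∷ []) ⊆ ρ ++ N ∷ r ∷ ρ′
    s = ++⁺ˡ ρ (refl ∷ refl ∷ minimum ρ′)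
    z≢N : z ≢ N
    z≢N refl with _ ∷ (z≢z ∷ _) ∷ _ ← unique-⊆ (refl ∷ refl ∷ s) (perm-unique p) = z≢z refl
    x≡ : x ≡ 2 + n
    x≡ = proj₁ (two-before-max p g (h≢1 ∘ cong just) (h≢N ∘ cong just) z≢N s)
  merge₁ : Image (_++ N ∷ []) (B (suc n)) π → M (suc n) π
  merge₁ ([]    , ((p , _) , _)       , refl) = ⊥-elim (¬Perm[] p)
  merge₁ (x ∷ ρ , (a@(p , _) , h≢1) , refl) =
    A-insert (x ∷ ρ) (λ { _ () }) (subst (A (2 + n)) (sym (++-identityʳ (x ∷ ρ))) a) , h≢1 ,
    λ { refl → <-irrefl refl (proj₂ (perm-bounds p (here refl))) }
  merge₂ : Image (insert-second N) (M n) π → M (suc n) π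
  merge₂ ([]    , ((p , _) , _)     , refl) = ⊥-elim (¬Perm[] p)
  merge₂ (x ∷ ρ , (a@(p , _) , h≢1 , _) , refl) =
    A-insert (x ∷ []) (λ { (_ ∷ʳ ()) ; (_ ∷ ()) }) a , h≢1 ,
    λ { refl → <-irrefl refl (proj₂ (perm-bounds p (here refl))) }
  merge₃ : C (suc n) π → M (suc n) π
  merge₃ (a , h≡ , _) = a ,
    (λ h≡1 → absurd (trans (sym h≡) h≡1)) ,
    (λ h≡N → 1+n≢n (sym (just-injective (trans (sym h≡) h≡N))))
    where
    absurd : just (2 + n) ≢ just 1
    absurd ()

-- The word is a shifted avoider with 1 prepended and its first two letters swapped. An occurrence
-- that misses one of these two letters was there before the swap. One that uses both would need two
-- letters above `2 + n`, or a letter below 1.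
A-insert-1-second : ∀ {n ρ} → A (2 + n) (1 + n ∷ ρ) → A (3 + n) (2 + n ∷ 1 ∷ map suc ρ)
A-insert-1-second {n} {ρ} a with p , g ← A-shift a = q , good
  where
  q : Perm (3 + n) (2 + n ∷ 1 ∷ map suc ρ)
  q = ↭-trans (swap _ _ ↭-refl) p
  good : Good (2 + n ∷ 1 ∷ map suc ρ)
  good (_ ∷ʳ _ ∷ʳ s)      f = g (_ ∷ʳ _ ∷ʳ s) f
  good (_ ∷ʳ (refl ∷ s))  f = g (refl ∷ _ ∷ʳ s) f
  good (refl ∷ (_ ∷ʳ s))  f = g (_ ∷ʳ refl ∷ s) f
  good (refl ∷ refl ∷ s)  (2143-like _ a<d d<c) =
    <⇒≱ (≤-<-trans a<d d<c) (proj₂ (perm-bounds q (there (there (⊆-lookup s (here refl))))))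
  good (refl ∷ refl ∷ s)  (xx41-like _ d<1 _ _) =
    <⇒≱ (proj₁ (perm-bounds q (there (there (⊆-lookup s (there (here refl))))))) (s≤s⁻¹ d<1)

-- The second letter decides: it is `N`, or else `two-before-max` forces it to be 1.
C-split : ∀ n π → C (suc n) π ⇔
  (Image (λ ρ → 2 + n ∷ 3 + n ∷ ρ) (A (1 + n)) π ⊎ Image insert-1-second (C n) π)
C-split n π = mk⇔ (split π) Sum.[ merge₁ , merge₂ ]
  where
  N = 3 + n
  split : ∀ π → C (suc n) π →
          Image (λ ρ → 2 + n ∷ N ∷ ρ) (A (1 + n)) π ⊎ Image insert-1-second (C n) π
  split (x ∷ z ∷ ρ) (a@(p , g) , refl , y , s) with z ≟ N
  -- Once `N` is gone, the head is the maximum and is deleted in the same way.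
  ... | yes refl = inj₁ (ρ , A-delete [] (A-delete (x ∷ []) a) , refl)
  ... | no z≢N with s′ ← ∷ʳ⁻ (z≢N ∘ sym) (∷ʳ⁻ 1+n≢n s)
               with _ , refl ← two-before-max p g (λ ()) (1+n≢n ∘ sym) z≢N s′
               -- Swapping brings the 1 to the front, where it can be removed and the other letters
               -- lowered.
               with x′ ∷ ρ′ , q , refl ← perm-unshift (↭-trans (swap _ _ ↭-refl) p)
               with _ ∷ y′ ∷ [] , refl , t ← ⊆-map-inv suc ρ′ s′
    = inj₂ (_ , ((q , good-map-suc⁻ (good-⊆ (refl ∷ _ ∷ʳ ⊆-refl) g)) , refl , y′ , _ ∷ʳ t) , refl)
  split (x ∷ []) (_ , refl , y , (_ ∷ʳ ()))
  split (x ∷ []) (_ , refl , y , (_ ∷ ()))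
  merge₁ : Image (λ ρ → 2 + n ∷ N ∷ ρ) (A (1 + n)) π → C (suc n) π
  merge₁ ([]    , (p , _) , refl) = ⊥-elim (¬Perm[] p)
  -- The remaining word is nonempty, and its first letter `y` witnesses that `N` is not last.
  merge₁ (y ∷ ρ , a , refl) =
    A-insert (2 + n ∷ []) (λ { (_ ∷ʳ ()) ; (_ ∷ ()) }) (A-insert [] (λ ()) a) , refl ,
    y , _ ∷ʳ refl ∷ refl ∷ minimum ρ
  merge₂ : Image insert-1-second (C n) π → C (suc n) π
  merge₂ (_ ∷ ρ , (a , refl , y , s) , refl) =
    A-insert-1-second a , refl , suc y , _ ∷ʳ _ ∷ʳ ⊆-map⁺ suc (∷ʳ⁻ 1+n≢n s)

-- The linear system for the sizes

∣A∣ ∣B∣ ∣M∣ ∣C∣ : ℕ → ℕ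
∣A∣ zero    = 1
∣A∣ (suc n) = ∣A∣ n + ∣B∣ n
∣B∣ zero    = 0
∣B∣ (suc n) = ∣A∣ (suc n) + ∣M∣ n
∣M∣ zero    = 0
∣M∣ (suc n) = ∣B∣ (suc n) + (∣M∣ n + ∣C∣ (suc n))
∣C∣ zero    = 0
∣C∣ (suc n) = ∣A∣ (suc n) + ∣C∣ n

count-A : ∀ n → Count (A n) (∣A∣ n)
count-B : ∀ n → Count (B n) (∣B∣ n)
count-M : ∀ n → Count (M n) (∣M∣ n)
count-C : ∀ n → Count (C n) (∣C∣ n)

count-A zero = record
  { list = [] ∷ [] ; unique = [] ∷ [] ; size = refl
  ; members = λ π → mk⇔ (λ { (here refl) → ↭-refl , λ () }) (empty π) }
  where
  empty : ∀ π → A 0 π → π ∈ [] ∷ []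
  empty []      _       = here refl
  empty (x ∷ π) (p , _) with () ← perm-length p
count-A (suc n) = count-⊎ (count-image prepend-1-injective (count-A n)) (count-B n)
  (λ { _ (ρ , _ , refl) (_ , h≢1) → h≢1 refl }) (A-split n)

count-B zero = count-∅ empty
  where
  empty : ∀ π → ¬ B 0 π
  empty []      ((p , _) , _) = ¬Perm[] p
  empty (x ∷ π) ((p , _) , h≢1) with 0<x , x≤1 ← perm-bounds p (here refl) =
    h≢1 (cong just (≤-antisym x≤1 0<x))
count-B (suc n) = count-⊎ (count-image ∷-injectiveʳ (count-A (suc n))) (count-M n)
  (λ { _ (ρ , _ , refl) (_ , _ , h≢N) → h≢N refl }) (B-split n)

count-M zero = count-∅ empty
  where
  empty : ∀ π → ¬ M 0 π
  empty []      ((p , _) , _) = ¬Perm[] p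
  empty (x ∷ π) ((p , _) , h≢1 , h≢2) with 0<x , x≤2 ← perm-bounds p (here refl)
    with m≤n⇒m<n∨m≡n x≤2
  ... | inj₁ x<2 = h≢1 (cong just (≤-antisym (s≤s⁻¹ x<2) 0<x))
  ... | inj₂ x≡2 = h≢2 (cong just x≡2)
count-M (suc n) = count-⊎ (count-image (++-cancelʳ (3 + n ∷ []) _ _) (count-B (suc n)))
  (count-⊎ (count-image insert-second-injective (count-M n)) (count-C (suc n))
    disjoint₂ λ _ → mk⇔ id id)
  disjoint₁ (M-split n)
  where
  -- Words of the first kind end in `N`; in the other two kinds a letter follows `N`. For
  -- `insert-second` this holds because words of `M n` have at least two letters.
  disjoint₁ : ∀ π → Image (_++ 3 + n ∷ []) (B (suc n)) π →
              ¬ (Image (insert-second (3 + n)) (M n) π ⊎ C (suc n) π)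
  disjoint₁ π i@(ρ , _ , refl) j
    with p , _ ← proj₁ (from (M-split n π) (inj₁ i)) = not-last {ρ = ρ} p (proj₂ (after j))
    where
    after : ∀ {π} → Image (insert-second (3 + n)) (M n) π ⊎ C (suc n) π → ∃ λ y → (3 + n ∷ y ∷ []) ⊆ π
    after (inj₂ (_ , _ , after))                   = after
    after (inj₁ (x ∷ y ∷ ρ , _ , refl))            = y , _ ∷ʳ refl ∷ refl ∷ minimum ρ
    after (inj₁ ([] , ((p , _) , _) , _))          = ⊥-elim (¬Perm[] p)
    after (inj₁ (_ ∷ [] , ((p , _) , _) , _)) with () ← perm-length p
  disjoint₂ : ∀ π → Image (insert-second (3 + n)) (M n) π → ¬ C (suc n) π
  disjoint₂ _ (x ∷ ρ , (_ , _ , h≢) , refl) (_ , h≡ , _) = h≢ h≡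

count-C zero = count-∅ empty
  where
  empty : ∀ π → ¬ C 0 π
  -- The head is 1, and a letter after the maximum 2 would have to differ from both 1 and 2.
  empty (x ∷ π) ((p , _) , refl , y , s)
    with s′ ← ∷ʳ⁻ (λ ()) s
    with (_ ∷ 1≢y ∷ []) ∷ (2≢y ∷ []) ∷ _ ← unique-⊆ (refl ∷ s′) (perm-unique p)
    with 0<y , y≤2 ← perm-bounds p (there (⊆-lookup s′ (there (here refl))))
    with m≤n⇒m<n∨m≡n y≤2
  ... | inj₁ y<2 = 1≢y (≤-antisym 0<y (s≤s⁻¹ y<2))
  ... | inj₂ y≡2 = 2≢y (sym y≡2)
count-C (suc n) = count-⊎ (count-image (∷-injectiveʳ ∘ ∷-injectiveʳ) (count-A (suc n)))
  (count-image insert-1-second-injective (count-C n)) disjoint (C-split n)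
  where
  disjoint : ∀ π → Image (λ ρ → 2 + n ∷ 3 + n ∷ ρ) (A (1 + n)) π → ¬ Image insert-1-second (C n) π
  disjoint _ (_ , _ , refl) (_ ∷ _ , _ , ())

-- The generating function

-- All sizes involved unfold to linear forms in `∣A∣ (1 + n)`, `∣M∣ n` and `∣C∣ n`, which reduces
-- the claim to an identity between such forms.
∣A∣-recurrence : ∀ n → ∣A∣ (4 + n) + 6 * ∣A∣ (2 + n) ≡ 5 * ∣A∣ (3 + n) + 3 * ∣A∣ (1 + n)
∣A∣-recurrence n = lemma (∣A∣ (1 + n)) (∣M∣ n) (∣C∣ n)
  where
  lemma : ∀ a m c →
    let b₁ = a + m ; a₂ = a + b₁ ; c₁ = a + c
        m₁ = b₁ + (m + c₁) ; b₂ = a₂ + m₁ ; a₃ = a₂ + b₂ ; c₂ = a₂ + c₁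
        m₂ = b₂ + (m₁ + c₂) ; b₃ = a₃ + m₂ ; a₄ = a₃ + b₃
    in a₄ + 6 * a₂ ≡ 5 * a₃ + 3 * a
  lemma = solve-∀

denominator : Series
denominator = poly (+ 1 ∷ - + 5 ∷ + 6 ∷ - + 3 ∷ [])

-- The three coefficients are those of the numerator that makes the first
-- three coefficients of the quotient equal to h 0, h 1 and h 2.
/-recurrence : ∀ (h : Series) →
  (∀ n → h (3 + n) ℤ.+ + 6 ℤ.* h (1 + n) ≡ + 5 ℤ.* h (2 + n) ℤ.+ + 3 ℤ.* h n) →
  ∀ f → f ≗ poly (h 0 ∷ h 1 ℤ.- + 5 ℤ.* h 0 ∷ h 2 ℤ.- + 5 ℤ.* h 1 ℤ.+ + 6 ℤ.* h 0 ∷ []) →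
  f / denominator ≗ h
/-recurrence h rec f eq zero    = eq 0
/-recurrence h rec f eq (suc n) = /-recurrence (h ∘ suc) (rec ∘ suc) _ eq′ n
  where
  open ≡-Reasoning
  f′ : Series
  f′ k = f (suc k) ℤ.- f 0 ℤ.* denominator (suc k)
  i₁ : ∀ x y → y ℤ.- + 5 ℤ.* x ℤ.- x ℤ.* - + 5 ≡ y
  i₁ = ℤ-solve-∀
  i₂ : ∀ x y z → z ℤ.- + 5 ℤ.* y ℤ.+ + 6 ℤ.* x ℤ.- x ℤ.* + 6 ≡ z ℤ.- + 5 ℤ.* y
  i₂ = ℤ-solve-∀
  i₃ : ∀ x y z → 0ℤ ℤ.- x ℤ.* - + 3 ≡ + 5 ℤ.* z ℤ.+ + 3 ℤ.* x ℤ.- + 5 ℤ.* z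
  i₃ = ℤ-solve-∀
  i₄ : ∀ y z w → w ℤ.+ + 6 ℤ.* y ℤ.- + 5 ℤ.* z ≡ w ℤ.- + 5 ℤ.* z ℤ.+ + 6 ℤ.* y
  i₄ = ℤ-solve-∀
  i₅ : ∀ x → 0ℤ ℤ.- x ℤ.* 0ℤ ≡ 0ℤ
  i₅ = ℤ-solve-∀
  -- One step of long division turns the numerator belonging to `h` into the one belonging to
  -- `h ∘ suc`; the recurrence at 0 supplies the coefficient in degree 2.
  eq′ : f′ ≗ poly (h 1 ∷ h 2 ℤ.- + 5 ℤ.* h 1 ∷ h 3 ℤ.- + 5 ℤ.* h 2 ℤ.+ + 6 ℤ.* h 1 ∷ [])
  eq′ k rewrite eq 0 | eq (suc k) with k
  ... | 0 = i₁ (h 0) (h 1)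
  ... | 1 = i₂ (h 0) (h 1) (h 2)
  ... | 2 = begin
    0ℤ ℤ.- h 0 ℤ.* - + 3                             ≡⟨ i₃ (h 0) (h 1) (h 2) ⟩
    + 5 ℤ.* h 2 ℤ.+ + 3 ℤ.* h 0 ℤ.- + 5 ℤ.* h 2      ≡⟨ cong (ℤ._- + 5 ℤ.* h 2) (rec 0) ⟨
    h 3 ℤ.+ + 6 ℤ.* h 1 ℤ.- + 5 ℤ.* h 2              ≡⟨ i₄ (h 1) (h 2) (h 3) ⟩
    h 3 ℤ.- + 5 ℤ.* h 2 ℤ.+ + 6 ℤ.* h 1              ∎
  ... | suc (suc (suc k)) = i₅ (h 0)

∣A∣-series : (λ n → + ∣A∣ n) ≗ poly (+ 1 ∷ - + 4 ∷ + 3 ∷ - + 1 ∷ []) / denominator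
∣A∣-series zero    = refl
-- Not at zero: the recurrence fails for ∣A∣ 0.
∣A∣-series (suc n) = sym (/-recurrence (λ n → + ∣A∣ (suc n)) rec _
  -- After one division step the numerator is 1 - 3x + 2x^2, which agrees with the sizes 1, 2, 6 at
  -- lengths 1, 2, 3.
  (λ { 0 → refl ; 1 → refl ; 2 → refl ; (suc (suc (suc k))) → refl }) n)
  where
  open ≡-Reasoning
  pos : ∀ j x k y → + (j * x + k * y) ≡ + j ℤ.* + x ℤ.+ + k ℤ.* + y
  pos j x k y = cong₂ ℤ._+_ (ℤ.pos-* j x) (ℤ.pos-* k y)
  rec : ∀ n → + ∣A∣ (4 + n) ℤ.+ + 6 ℤ.* + ∣A∣ (2 + n) ≡ + 5 ℤ.* + ∣A∣ (3 + n) ℤ.+ + 3 ℤ.* + ∣A∣ (1 + n)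
  rec n = begin
    + ∣A∣ (4 + n) ℤ.+ + 6 ℤ.* + ∣A∣ (2 + n)  ≡⟨ cong (λ x → + ∣A∣ (4 + n) ℤ.+ x) (ℤ.pos-* 6 (∣A∣ (2 + n))) ⟨
    + (∣A∣ (4 + n) + 6 * ∣A∣ (2 + n))  ≡⟨ cong +_ (∣A∣-recurrence n) ⟩
    + (5 * ∣A∣ (3 + n) + 3 * ∣A∣ (1 + n)) ≡⟨ pos 5 (∣A∣ (3 + n)) 3 (∣A∣ (1 + n)) ⟩
    + 5 ℤ.* + ∣A∣ (3 + n) ℤ.+ + 3 ℤ.* + ∣A∣ (1 + n) ∎

theorem23 : F ((2 ∷ 1 ∷ 4 ∷ 3 ∷ []) ∷ (2 ∷ 3 ∷ 4 ∷ 1 ∷ []) ∷ (3 ∷ 2 ∷ 4 ∷ 1 ∷ []) ∷ [])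
    ≗ (poly (+ 1 ∷ - + 4 ∷ + 3 ∷ - + 1 ∷ []) / poly (+ 1 ∷ - + 5 ∷ + 6 ∷ - + 3 ∷ []))
theorem23 n = trans (cong +_ (count-unique (∣S∣-count n) (count-A n))) (∣A∣-series n)
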